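{- For non-negative integers $v,h$ and an integer $a$, let $\mathbb{Y}_{v+1,h+1,a}$ be the set of shortest lattice paths from $(0,0)$ to $(h+1,v+1)$ such that the number of cells on the upper-left side of the path is congruent to $a$ modulo $v+h+2$. For $\mathbf{y}\in\mathbb{Y}_{v+1,h+1,a}$ let $\mathrm{dS}_{PATH}(\mathbf{y})$ denote the set of paths in $\mathbb{Y}_{v,h}$ obtained as follows: if $\mathbf{y}$ begins with a horizontal step $y_1$, delete $y_1$ and some vertical step $y_j$; if $\mathbf{y}$ begins with a vertical step $y_1$, delete $y_1$ and some horizontal step $y_j$. Then $\{\mathrm{dS}_{PATH}(\mathbf{y})\mid\mathbf{y}\in\mathbb{Y}_{v+1,h+1,a}\}$ is a partition of $\mathbb{Y}_{v,h}$; that is, the sets $\mathrm{dS}_{PATH}(\mathbf{y})$ for different $\mathbf{y}\in\mathbb{Y}_{v+1,h+1,a}$ are disjoint and their union is $\mathbb{Y}_{v,h}$.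
   Context: $\mathbb{Y}_{v,h}$ is the set of bit sequences in $\{0,1\}^{v+h}$ with exactly $v$ zeros and $h$ ones. Such a sequence is identified with a shortest lattice path (unit steps right and up) from $(0,0)$ to $(h,v)$ by reading $0$ as a vertical (up) step and $1$ as a horizontal (right) step. The cells on the upper-left side of the path are the unit cells of the rectangle $[0,h]\times[0,v]$ lying above and to the left of the path; their number equals $\mathrm{inv}(\mathbf{x})=\#\{(i,j)\mid i<j,\ x_i>x_j\}$ for the corresponding bit sequence $\mathbf{x}$. All possible choices of the second deleted step $y_j$ are allowed; deleting two steps means removing them from the sequence and concatenating the rest. -}

module Defs where

open import Data.Integer.Base as ℤ using (ℤ; +_)
open import Data.Integer.Divisibility using () renaming (_∣_ to _∣ℤ_)
open import Data.List.Base
  using (List; []; _∷_; length; filter; lookup; removeAt; upTo; cartesianProduct)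
open import Data.List.Scans.Base using (scanl)
open import Data.List.Relation.Unary.Any using (Any; any?)
open import Data.Nat.Base using (ℕ; suc; _+_; _≤_; _<_)
open import Data.Nat.Properties using (_≤?_; _<?_)
open import Data.Product.Base using (_×_; _,_; ∃-syntax)
open import Level using (0ℓ)
open import Relation.Binary.Definitions using (DecidableEquality)
open import Relation.Binary.PropositionalEquality using (_≡_; _≢_; refl)
open import Relation.Nullary.Decidable using (yes; no; _×-dec_)
open import Relation.Unary using (Pred; Decidable; Satisfiable; ∅; _∈_; _⊥_; _≐_)

-- The bit 0 is `up` (a vertical step), the bit 1 is `right` (a horizontal step).
data Step : Set where
  up right : Step

infix 4 _≟_
_≟_ : DecidableEquality Step
up    ≟ up    = yes refl
up    ≟ right = no λ ()
right ≟ up    = no λ ()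
right ≟ right = yes refl

Path : Set
Path = List Step

#_ : Step → Path → ℕ
(# s) p = length (filter (_≟ s) p)

-- The length v + h of the sequence is implied by the two counts.
𝕐 : (v h : ℕ) → Pred Path 0ℓ
𝕐 v h p = (# up) p ≡ v × (# right) p ≡ h

-- Lattice points (x , y), x being the horizontal coordinate.
Point : Set
Point = ℕ × ℕ

move : Point → Step → Point
move (x , y) up    = x , suc y
move (x , y) right = suc x , y

vertices : Path → List Point
vertices = scanl move (0 , 0)

-- The cell (i , j) is the unit square [i , i + 1] × [j , j + 1].
Cell : Set
Cell = ℕ × ℕ

-- A cell is on the upper-left side of a path when it lies, as a whole, above
-- and to the left of some vertex (x , y) of the path: i + 1 ≤ x and y ≤ j.
UpperLeft : Path → Pred Cell 0ℓ
UpperLeft p (i , j) = Any (λ (x , y) → i < x × y ≤ j) (vertices p)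

upperLeft? : ∀ p → Decidable (UpperLeft p)
upperLeft? p (i , j) = any? (λ (x , y) → i <? x ×-dec y ≤? j) (vertices p)

-- For p ∈ 𝕐 v h the ambient rectangle is [0 , h] × [0 , v].
upperLeftCells : (v h : ℕ) → Path → List Cell
upperLeftCells v h p = filter (upperLeft? p) (cartesianProduct (upTo h) (upTo v))

infix 4 _≡_[mod_]
_≡_[mod_] : ℤ → ℤ → ℕ → Set
x ≡ y [mod m ] = + m ∣ℤ (x ℤ.- y)

-- 𝕐⁺ v h a is the set written 𝕐_{v+1,h+1,a}.
𝕐⁺ : (v h : ℕ) → ℤ → Pred Path 0ℓ
𝕐⁺ v h a p =
  p ∈ 𝕐 (suc v) (suc h) ×
  + length (upperLeftCells (suc v) (suc h) p) ≡ a [mod v + h + 2 ]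

-- The index j ranges over the tail, so the deleted step is never y₁ itself.
-- The empty path, which is in no 𝕐⁺ v h a, has no first step to delete.
dS-PATH : Path → Pred Path 0ℓ
dS-PATH []           = ∅
dS-PATH (right ∷ ys) = λ x → ∃[ j ] (lookup ys j ≡ up    × x ≡ removeAt ys j)
dS-PATH (up    ∷ ys) = λ x → ∃[ j ] (lookup ys j ≡ right × x ≡ removeAt ys j)

-- The blocks B i, i ∈ J, partition S. Different indices (not merely different
-- blocks) must give disjoint blocks.
record IsPartition {I A : Set} (J : Pred I 0ℓ) (B : I → Pred A 0ℓ) (S : Pred A 0ℓ) : Set where
  field
    nonempty : ∀ {i} → i ∈ J → Satisfiable (B i)
    disjoint : ∀ {i j} → i ∈ J → j ∈ J → i ≢ j → B i ⊥ B j
    union    : (λ x → ∃[ i ] (i ∈ J × x ∈ B i)) ≐ S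

{-# OPTIONS --safe #-}

-- The area above a path y is inv y. If x ∈ 𝕐 v h arises from y by deleting the
-- first step and an opposite one, then inv y − inv x is v + 1 + k when y starts
-- with a right step and the deleted up step has k ≤ h right steps of x before
-- it, and is v − k when y starts with an up step and the deleted right step has
-- k ≤ v up steps of x before it. In both cases k determines y, so the paths y
-- above x correspond bijectively to the excesses 0, …, v + h + 1, a complete
-- residue system modulo v + h + 2.
module Submission where

open import Defs
open import Data.Bool.Base using (true; false)
open import Data.Fin.Base using (zero; suc)
open import Data.Integer.Base as ℤ using (ℤ; +_; ∣_∣)
import Data.Integer.Divisibility.Signed as Signed
open import Data.Integer.DivMod using (_%ℕ_; _/ℕ_; n%ℕd<d; a≡a%ℕn+[a/ℕn]*n)
open import Data.Integer.Properties as ℤ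
  using (∣m⊝n∣≤m⊔n; [+m]-[+n]≡m⊖n; ∣i∣≡0⇒i≡0; i-j≡0⇒i≡j)
open import Data.Integer.Tactic.RingSolver using () renaming (solve-∀ to ℤ-solve-∀)
open import Data.List.Base
  using (List; []; _∷_; _++_; length; map; filter; foldl; inits; lookup; removeAt
        ; upTo; applyUpTo; cartesianProduct)
open import Data.List.Properties
  using (map-∘; map-cong; map-++; map-upTo; length-map; length-upTo; length-++
        ; filter-++; filter-all; filter-reject; filter-≐)
open import Data.List.Relation.Unary.All using (universal)
import Data.List.Relation.Unary.All.Properties as All
open import Data.List.Relation.Unary.Any using (Any; here; there)
import Data.List.Relation.Unary.Any as Any
import Data.List.Relation.Unary.Any.Properties as Any
open import Data.List.Scans.Properties using (scanl-defn)
open import Data.Nat.Base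
open import Data.Nat.Divisibility using (_∣_; ∣⇒≤)
open import Data.Nat.Properties hiding (_≟_)
open import Data.Nat.Tactic.RingSolver using (solve-∀)
open import Data.Product.Base as Product using (_×_; _,_; ∃-syntax; proj₁; proj₂; map₁; map₂)
open import Function.Base using (_∘_; id)
open import Relation.Binary.PropositionalEquality
open import Relation.Nullary using (¬_; yes; no; does; contradiction)
open import Relation.Unary using (Pred; Decidable; _∈_; _≐_)

open ≡-Reasoning

-- Filters and Cartesian products of lists

module _ {a p} {A : Set a} {P : Pred A p} (P? : Decidable P) where

  filter-map : ∀ {b} {B : Set b} (f : B → A) xs →
               filter P? (map f xs) ≡ map f (filter (P? ∘ f) xs)
  filter-map f []       = refl
  filter-map f (x ∷ xs) with does (P? (f x))
  ... | true  = cong (f x ∷_) (filter-map f xs)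
  ... | false = filter-map f xs

  length-filter-map : ∀ {b q} {B : Set b} {Q : Pred B q} (Q? : Decidable Q) (f : B → A) →
                      (P ∘ f) ≐ Q → ∀ xs →
                      length (filter P? (map f xs)) ≡ length (filter Q? xs)
  length-filter-map Q? f Pf≐Q xs = begin
    length (filter P? (map f xs))          ≡⟨ cong length (filter-map f xs) ⟩
    length (map f (filter (P? ∘ f) xs))    ≡⟨ length-map f (filter (P? ∘ f) xs) ⟩
    length (filter (P? ∘ f) xs)            ≡⟨ cong length (filter-≐ (P? ∘ f) Q? Pf≐Q xs) ⟩
    length (filter Q? xs)                  ∎

module _ {a b} {A : Set a} {B : Set b} where

  cartesianProduct-mapˡ : ∀ {c} {C : Set c} (f : C → A) xs (ys : List B) →
    cartesianProduct (map f xs) ys ≡ map (map₁ f) (cartesianProduct xs ys)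
  cartesianProduct-mapˡ f []       ys = refl
  cartesianProduct-mapˡ f (x ∷ xs) ys = begin
    map (f x ,_) ys ++ cartesianProduct (map f xs) ys
      ≡⟨ cong₂ _++_ (map-∘ ys) (cartesianProduct-mapˡ f xs ys) ⟩
    map (map₁ f) (map (x ,_) ys) ++ map (map₁ f) (cartesianProduct xs ys)
      ≡⟨ map-++ (map₁ f) (map (x ,_) ys) _ ⟨
    map (map₁ f) (map (x ,_) ys ++ cartesianProduct xs ys) ∎

  cartesianProduct-mapʳ : ∀ {c} {C : Set c} (f : C → B) (xs : List A) ys →
    cartesianProduct xs (map f ys) ≡ map (map₂ f) (cartesianProduct xs ys)
  cartesianProduct-mapʳ f []       ys = refl
  cartesianProduct-mapʳ f (x ∷ xs) ys = begin
    map (x ,_) (map f ys) ++ cartesianProduct xs (map f ys)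
      ≡⟨ cong₂ _++_ (trans (sym (map-∘ ys)) (map-∘ ys)) (cartesianProduct-mapʳ f xs ys) ⟩
    map (map₂ f) (map (x ,_) ys) ++ map (map₂ f) (cartesianProduct xs ys)
      ≡⟨ map-++ (map₂ f) (map (x ,_) ys) _ ⟨
    map (map₂ f) (map (x ,_) ys ++ cartesianProduct xs ys) ∎

  -- The product is listed column by column, so the rejected row contributes one entry at the head
  -- of each column; these are dropped one column at a time.
  filter-cartesianProduct-rejectʳ :
    ∀ {p} {P : Pred (A × B) p} (P? : Decidable P) {y} → (∀ x → ¬ P (x , y)) → ∀ xs ys →
    filter P? (cartesianProduct xs (y ∷ ys)) ≡ filter P? (cartesianProduct xs ys)
  filter-cartesianProduct-rejectʳ P? ¬P []       ys = refl
  filter-cartesianProduct-rejectʳ P? {y} ¬P (x ∷ xs) ys = begin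
    filter P? ((x , y) ∷ map (x ,_) ys ++ cartesianProduct xs (y ∷ ys))
      ≡⟨ filter-reject P? (¬P x) ⟩
    filter P? (map (x ,_) ys ++ cartesianProduct xs (y ∷ ys))
      ≡⟨ filter-++ P? (map (x ,_) ys) _ ⟩
    filter P? (map (x ,_) ys) ++ filter P? (cartesianProduct xs (y ∷ ys))
      ≡⟨ cong (_ ++_) (filter-cartesianProduct-rejectʳ P? ¬P xs ys) ⟩
    filter P? (map (x ,_) ys) ++ filter P? (cartesianProduct xs ys)
      ≡⟨ filter-++ P? (map (x ,_) ys) _ ⟨
    filter P? (map (x ,_) ys ++ cartesianProduct xs ys) ∎

-- Counting the cells on the upper-left side

move-comm : ∀ z s t → move (move z s) t ≡ move (move z t) s
move-comm z up    up    = refl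
move-comm z up    right = refl
move-comm z right up    = refl
move-comm z right right = refl

foldl-move : ∀ z s p → foldl move (move z s) p ≡ move (foldl move z p) s
foldl-move z s []      = refl
foldl-move z s (t ∷ p) = begin
  foldl move (move (move z s) t) p ≡⟨ cong (λ z → foldl move z p) (move-comm z s t) ⟩
  foldl move (move (move z t) s) p ≡⟨ foldl-move (move z t) s p ⟩
  move (foldl move (move z t) p) s ∎

-- The vertices are the end points of the prefixes. Moves are commuting translations, so by
-- `foldl-move` the first step may be made last, where it translates each vertex of `p`.
vertices-∷ : ∀ s p → vertices (s ∷ p) ≡ (0 , 0) ∷ map (λ z → move z s) (vertices p)
vertices-∷ s p = begin
  vertices (s ∷ p)
    ≡⟨ scanl-defn move (0 , 0) (s ∷ p) ⟩
  (0 , 0) ∷ map (foldl move (0 , 0)) (map (s ∷_) (inits p))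
    ≡⟨ cong ((0 , 0) ∷_) (map-∘ (inits p)) ⟨
  (0 , 0) ∷ map (foldl move (move (0 , 0) s)) (inits p)
    ≡⟨ cong ((0 , 0) ∷_) (map-cong (foldl-move (0 , 0) s) (inits p)) ⟩
  (0 , 0) ∷ map (λ q → move (foldl move (0 , 0) q) s) (inits p)
    ≡⟨ cong ((0 , 0) ∷_) (map-∘ (inits p)) ⟩
  (0 , 0) ∷ map (λ z → move z s) (map (foldl move (0 , 0)) (inits p))
    ≡⟨ cong (λ zs → (0 , 0) ∷ map (λ z → move z s) zs) (scanl-defn move (0 , 0) p) ⟨
  (0 , 0) ∷ map (λ z → move z s) (vertices p) ∎

-- No cell lies to the left of the initial vertex (0 , 0).
UpperLeft-∷⁻ : ∀ s p {i j} → UpperLeft (s ∷ p) (i , j) →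
               Any (λ z → i < proj₁ (move z s) × proj₂ (move z s) ≤ j) (vertices p)
UpperLeft-∷⁻ s p {i} {j} u with subst (Any _) (vertices-∷ s p) u
... | there u′ = Any.map⁻ u′

UpperLeft-∷⁺ : ∀ s p {i j} →
               Any (λ z → i < proj₁ (move z s) × proj₂ (move z s) ≤ j) (vertices p) →
               UpperLeft (s ∷ p) (i , j)
UpperLeft-∷⁺ s p u = subst (Any _) (sym (vertices-∷ s p)) (there (Any.map⁺ u))

¬UpperLeft-up-bottom : ∀ p i → ¬ UpperLeft (up ∷ p) (i , 0)
¬UpperLeft-up-bottom p i u with Any.satisfied (UpperLeft-∷⁻ up p u)
... | _ , _ , ()

UpperLeft-up : ∀ p → (UpperLeft (up ∷ p) ∘ map₂ suc) ≐ UpperLeft p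
UpperLeft-up p =
  (λ {(i , j)} u → Any.map (map₂ s≤s⁻¹) (UpperLeft-∷⁻ up p {i} {suc j} u)) ,
  (λ {(i , j)} u → UpperLeft-∷⁺ up p {i} {suc j} (Any.map (map₂ s≤s) u))

UpperLeft-right-first : ∀ p j → UpperLeft (right ∷ p) (0 , j)
UpperLeft-right-first p j = UpperLeft-∷⁺ right p {0} {j} (here (s≤s z≤n , z≤n))

UpperLeft-right : ∀ p → (UpperLeft (right ∷ p) ∘ map₁ suc) ≐ UpperLeft p
UpperLeft-right p =
  (λ {(i , j)} u → Any.map (map₁ s≤s⁻¹) (UpperLeft-∷⁻ right p {suc i} {j} u)) ,
  (λ {(i , j)} u → UpperLeft-∷⁺ right p {suc i} {j} (Any.map (map₁ s≤s) u))

-- No cell of the bottom row qualifies, and the rows above it are the rectangle of `p` shifted up by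
-- one.
length-upperLeftCells-up : ∀ v h p →
  length (upperLeftCells (suc v) h (up ∷ p)) ≡ length (upperLeftCells v h p)
length-upperLeftCells-up v h p = begin
  length (filter P? (cartesianProduct (upTo h) (0 ∷ applyUpTo suc v)))
    ≡⟨ cong length (filter-cartesianProduct-rejectʳ P? (¬UpperLeft-up-bottom p) (upTo h) _) ⟩
  length (filter P? (cartesianProduct (upTo h) (applyUpTo suc v)))
    ≡⟨ cong (λ ys → length (filter P? (cartesianProduct (upTo h) ys))) (map-upTo suc v) ⟨
  length (filter P? (cartesianProduct (upTo h) (map suc (upTo v))))
    ≡⟨ cong (length ∘ filter P?) (cartesianProduct-mapʳ suc (upTo h) (upTo v)) ⟩
  length (filter P? (map (map₂ suc) (cartesianProduct (upTo h) (upTo v))))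
    ≡⟨ length-filter-map P? (upperLeft? p) (map₂ suc) (UpperLeft-up p)
         (cartesianProduct (upTo h) (upTo v)) ⟩
  length (upperLeftCells v h p) ∎
  where P? = upperLeft? (up ∷ p)

-- The first column qualifies in full, and the columns after it are the rectangle of `p` shifted
-- right by one.
length-upperLeftCells-right : ∀ v h p →
  length (upperLeftCells v (suc h) (right ∷ p)) ≡ v + length (upperLeftCells v h p)
length-upperLeftCells-right v h p = begin
  length (filter P? (column ++ rest))
    ≡⟨ cong length (filter-++ P? column rest) ⟩
  length (filter P? column ++ filter P? rest)
    ≡⟨ length-++ (filter P? column) ⟩
  length (filter P? column) + length (filter P? rest)
    ≡⟨ cong₂ _+_ column-length rest-length ⟩
  v + length (upperLeftCells v h p) ∎
  where
  P?     = upperLeft? (right ∷ p)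
  column = map (0 ,_) (upTo v)
  rest   = cartesianProduct (applyUpTo suc h) (upTo v)

  column-length : length (filter P? column) ≡ v
  column-length = begin
    length (filter P? column)
      ≡⟨ cong length (filter-all P? (All.map⁺ (universal (UpperLeft-right-first p) (upTo v)))) ⟩
    length column   ≡⟨ length-map {B = ℕ × ℕ} (0 ,_) (upTo v) ⟩
    length (upTo v) ≡⟨ length-upTo v ⟩
    v               ∎

  rest-length : length (filter P? rest) ≡ length (upperLeftCells v h p)
  rest-length = begin
    length (filter P? rest)
      ≡⟨ cong (λ xs → length (filter P? (cartesianProduct xs (upTo v)))) (map-upTo suc h) ⟨
    length (filter P? (cartesianProduct (map suc (upTo h)) (upTo v)))
      ≡⟨ cong (length ∘ filter P?) (cartesianProduct-mapˡ suc (upTo h) (upTo v)) ⟩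
    length (filter P? (map (map₁ suc) (cartesianProduct (upTo h) (upTo v))))
      ≡⟨ length-filter-map P? (upperLeft? p) (map₁ suc) (UpperLeft-right p)
           (cartesianProduct (upTo h) (upTo v)) ⟩
    length (upperLeftCells v h p) ∎

-- The inversion number of the bit sequence: each right step is paired with the up steps after it.
inv : Path → ℕ
inv []          = 0
inv (up    ∷ p) = inv p
inv (right ∷ p) = (# up) p + inv p

-- Both sides obey the same recursion on the first step: an up step adds nothing, and a right step
-- adds a full column, whose height is the number of up steps still to come.
length-upperLeftCells : ∀ {v h p} → p ∈ 𝕐 v h → length (upperLeftCells v h p) ≡ inv p
length-upperLeftCells {p = []}        (refl , refl) = refl
length-upperLeftCells {p = up ∷ p}    (refl , refl) =
  trans (length-upperLeftCells-up ((# up) p) ((# right) p) p) (length-upperLeftCells {p = p} (refl , refl))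
length-upperLeftCells {p = right ∷ p} (refl , refl) =
  trans (length-upperLeftCells-right ((# up) p) ((# right) p) p)
        (cong (_+_ ((# up) p)) (length-upperLeftCells {p = p} (refl , refl)))

-- Inserting a step

opposite : Step → Step
opposite up    = right
opposite right = up

-- Inserts s directly after the k-th step opposite to s, or at the end of the
-- path if there are fewer than k such steps.
insertAfter : Step → ℕ → Path → Path
insertAfter s     zero    p           = s ∷ p
insertAfter s     (suc k) []          = s ∷ []
insertAfter up    (suc k) (up    ∷ p) = up    ∷ insertAfter up    (suc k) p
insertAfter up    (suc k) (right ∷ p) = right ∷ insertAfter up    k       p
insertAfter right (suc k) (up    ∷ p) = up    ∷ insertAfter right k       p
insertAfter right (suc k) (right ∷ p) = right ∷ insertAfter right (suc k) p

-- Within a run of equal steps the place of insertion does not matter. This lets an insertion be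
-- described by the number of opposite steps before it alone.
insertAfter-same : ∀ s k p → s ∷ insertAfter s k p ≡ insertAfter s k (s ∷ p)
insertAfter-same s     zero    p = refl
insertAfter-same up    (suc k) p = refl
insertAfter-same right (suc k) p = refl

removeAt-insertAfter : ∀ s k p →
  ∃[ j ] (lookup (insertAfter s k p) j ≡ s × p ≡ removeAt (insertAfter s k p) j)
removeAt-insertAfter s     zero    p           = zero , refl , refl
removeAt-insertAfter s     (suc k) []          = zero , refl , refl
removeAt-insertAfter up    (suc k) (up    ∷ p) with removeAt-insertAfter up (suc k) p
... | j , l , r = suc j , l , cong (up ∷_) r
removeAt-insertAfter up    (suc k) (right ∷ p) with removeAt-insertAfter up k p
... | j , l , r = suc j , l , cong (right ∷_) r
removeAt-insertAfter right (suc k) (up    ∷ p) with removeAt-insertAfter right k p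
... | j , l , r = suc j , l , cong (up ∷_) r
removeAt-insertAfter right (suc k) (right ∷ p) with removeAt-insertAfter right (suc k) p
... | j , l , r = suc j , l , cong (right ∷_) r

-- The witness `k` is the number of opposite steps before position `j`. Positions in the same run of
-- `s` share one `k`, by `insertAfter-same`.
insertAfter-removeAt : ∀ s p j → lookup p j ≡ s →
  ∃[ k ] (k ≤ (# opposite s) (removeAt p j) × p ≡ insertAfter s k (removeAt p j))
insertAfter-removeAt s     (t     ∷ p) zero    refl = 0 , z≤n , refl
insertAfter-removeAt up    (up    ∷ p) (suc j) l with insertAfter-removeAt up p j l
... | k , k≤ , eq = k , k≤ , trans (cong (up ∷_) eq) (insertAfter-same up k _)
insertAfter-removeAt up    (right ∷ p) (suc j) l with insertAfter-removeAt up p j l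
... | k , k≤ , eq = suc k , s≤s k≤ , cong (right ∷_) eq
insertAfter-removeAt right (up    ∷ p) (suc j) l with insertAfter-removeAt right p j l
... | k , k≤ , eq = suc k , s≤s k≤ , cong (up ∷_) eq
insertAfter-removeAt right (right ∷ p) (suc j) l with insertAfter-removeAt right p j l
... | k , k≤ , eq = k , k≤ , trans (cong (right ∷_) eq) (insertAfter-same right k _)

insertAfter-up-𝕐 : ∀ {v h} k p → p ∈ 𝕐 v h → insertAfter up k p ∈ 𝕐 (suc v) h
insertAfter-up-𝕐 zero    p           (refl , refl) = refl , refl
insertAfter-up-𝕐 (suc k) []          (refl , refl) = refl , refl
insertAfter-up-𝕐 (suc k) (up    ∷ p) (refl , refl) with insertAfter-up-𝕐 (suc k) p (refl , refl)
... | u , r = cong suc u , r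
insertAfter-up-𝕐 (suc k) (right ∷ p) (refl , refl) with insertAfter-up-𝕐 k p (refl , refl)
... | u , r = u , cong suc r

insertAfter-right-𝕐 : ∀ {v h} k p → p ∈ 𝕐 v h → insertAfter right k p ∈ 𝕐 v (suc h)
insertAfter-right-𝕐 zero    p           (refl , refl) = refl , refl
insertAfter-right-𝕐 (suc k) []          (refl , refl) = refl , refl
insertAfter-right-𝕐 (suc k) (up    ∷ p) (refl , refl) with insertAfter-right-𝕐 k p (refl , refl)
... | u , r = cong suc u , r
insertAfter-right-𝕐 (suc k) (right ∷ p) (refl , refl) with insertAfter-right-𝕐 (suc k) p (refl , refl)
... | u , r = u , cong suc r

-- The new up step forms an inversion with exactly the `k` right steps before it; the bound on `k`
-- ensures that there are that many.
inv-insertAfter-up : ∀ k p → k ≤ (# right) p → inv (insertAfter up k p) ≡ inv p + k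
inv-insertAfter-up zero    p           k≤       = sym (+-identityʳ (inv p))
inv-insertAfter-up (suc k) (up    ∷ p) k≤       = inv-insertAfter-up (suc k) p k≤
inv-insertAfter-up (suc k) (right ∷ p) (s≤s k≤) = begin
  (# up) (insertAfter up k p) + inv (insertAfter up k p)
    ≡⟨ cong₂ _+_ (proj₁ (insertAfter-up-𝕐 k p (refl , refl))) (inv-insertAfter-up k p k≤) ⟩
  suc ((# up) p) + (inv p + k)
    ≡⟨ rearrange ((# up) p) (inv p) k ⟩
  (# up) p + inv p + suc k ∎
  where
  rearrange : ∀ a b c → suc a + (b + c) ≡ a + b + suc c
  rearrange = solve-∀

-- The new right step forms an inversion with each up step after it, that is, with all but `k` of
-- them. Having `k` on the left avoids truncated subtraction.
inv-insertAfter-right : ∀ k p → k ≤ (# up) p →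
                        inv (insertAfter right k p) + k ≡ inv p + (# up) p
inv-insertAfter-right zero    p           k≤       = trans (+-identityʳ _) (+-comm ((# up) p) (inv p))
inv-insertAfter-right (suc k) (up    ∷ p) (s≤s k≤) = begin
  inv (insertAfter right k p) + suc k   ≡⟨ +-suc _ k ⟩
  suc (inv (insertAfter right k p) + k) ≡⟨ cong suc (inv-insertAfter-right k p k≤) ⟩
  suc (inv p + (# up) p)                ≡⟨ +-suc (inv p) _ ⟨
  inv p + suc ((# up) p)                ∎
inv-insertAfter-right (suc k) (right ∷ p) k≤ = begin
  (# up) (insertAfter right (suc k) p) + inv (insertAfter right (suc k) p) + suc k
    ≡⟨ +-assoc ((# up) (insertAfter right (suc k) p)) _ _ ⟩
  (# up) (insertAfter right (suc k) p) + (inv (insertAfter right (suc k) p) + suc k)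
    ≡⟨ cong₂ _+_ (proj₁ (insertAfter-right-𝕐 (suc k) p (refl , refl)))
                 (inv-insertAfter-right (suc k) p k≤) ⟩
  (# up) p + (inv p + (# up) p)
    ≡⟨ +-assoc ((# up) p) _ _ ⟨
  (# up) p + inv p + (# up) p ∎


-- The paths whose block contains a given path

-- The paths that contain x in their block, indexed by the excess of their inv
-- over that of x.
extend : Path → ℕ → Path
extend x c with c ≤? (# up) x
... | yes _ = up    ∷ insertAfter right ((# up) x ∸ c) x
... | no  _ = right ∷ insertAfter up (c ∸ suc ((# up) x)) x

extend-up : ∀ {x k} → k ≤ (# up) x → extend x ((# up) x ∸ k) ≡ up ∷ insertAfter right k x
extend-up {x} {k} k≤ with (# up) x ∸ k ≤? (# up) x
... | yes _ = cong (λ k → up ∷ insertAfter right k x) (m∸[m∸n]≡n k≤)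
... | no  ≰ = contradiction (m∸n≤m ((# up) x) k) ≰

extend-right : ∀ {x} k → extend x (suc ((# up) x + k)) ≡ right ∷ insertAfter up k x
extend-right {x} k with suc ((# up) x + k) ≤? (# up) x
... | yes ≤ = contradiction (m≤m+n ((# up) x) k) (<⇒≱ ≤)
... | no  _ = cong (λ k → right ∷ insertAfter up k x) (m+n∸m≡n ((# up) x) k)

extend-𝕐 : ∀ {v h x} c → x ∈ 𝕐 v h → extend x c ∈ 𝕐 (suc v) (suc h)
extend-𝕐 {x = x} c x∈ with c ≤? (# up) x
... | yes _ = map₁ (cong suc) (insertAfter-right-𝕐 ((# up) x ∸ c) x x∈)
... | no  _ = map₂ (cong suc) (insertAfter-up-𝕐 (c ∸ suc ((# up) x)) x x∈)

∈-dS-extend : ∀ x c → x ∈ dS-PATH (extend x c)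
∈-dS-extend x c with c ≤? (# up) x
... | yes _ = removeAt-insertAfter right ((# up) x ∸ c) x
... | no  _ = removeAt-insertAfter up (c ∸ suc ((# up) x)) x

-- Completeness of the indexing by excess: the position of the deleted step, read as the number `k`
-- of opposite steps before it, determines the index `c`.
∈-dS⇒extend : ∀ {x} y → x ∈ dS-PATH y →
              ∃[ c ] (c < (# up) x + (# right) x + 2 × y ≡ extend x c)
∈-dS⇒extend {x} (up ∷ ys) (j , l , refl) with insertAfter-removeAt right ys j l
... | k , k≤ , eq =
  (# up) x ∸ k , c< , trans (cong (up ∷_) eq) (sym (extend-up {x} k≤))
  where
  c< : (# up) x ∸ k < (# up) x + (# right) x + 2
  c< = ≤-<-trans (≤-trans (m∸n≤m _ k) (m≤m+n _ ((# right) x))) (m<m+n _ z<s)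
∈-dS⇒extend {x} (right ∷ ys) (j , l , refl) with insertAfter-removeAt up ys j l
... | k , k≤ , eq =
  suc ((# up) x + k) , c< , trans (cong (right ∷_) eq) (sym (extend-right {x} k))
  where
  c< : suc ((# up) x + k) < (# up) x + (# right) x + 2
  -- The extreme case `k` = `(# right) x` gives the largest excess, one below the modulus.
  c< = subst (suc ((# up) x + k) <_) (+-comm 2 _) (s<s (s≤s (+-monoʳ-≤ ((# up) x) k≤)))

-- A leading up step adds no inversion, so the inserted right step accounts for all of `c`. A
-- leading right step is inverted with every up step after it, those of `x` and the inserted one,
-- and the inserted up step adds `k` more.
inv-extend : ∀ x c → c < (# up) x + (# right) x + 2 → inv (extend x c) ≡ inv x + c
inv-extend x c c< with c ≤? (# up) x
... | yes c≤ = +-cancelʳ-≡ k _ _ (begin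
  inv (insertAfter right k x) + k ≡⟨ inv-insertAfter-right k x (m∸n≤m _ c) ⟩
  inv x + (# up) x                ≡⟨ cong (_+_ (inv x)) (m+[n∸m]≡n c≤) ⟨
  inv x + (c + k)                 ≡⟨ +-assoc (inv x) c k ⟨
  inv x + c + k                   ∎)
  where k = (# up) x ∸ c
... | no  c≰ = begin
  (# up) (insertAfter up k x) + inv (insertAfter up k x)
    ≡⟨ cong₂ _+_ (proj₁ (insertAfter-up-𝕐 k x (refl , refl))) (inv-insertAfter-up k x k≤) ⟩
  suc ((# up) x) + (inv x + k) ≡⟨ rearrange (suc ((# up) x)) (inv x) k ⟩
  inv x + (suc ((# up) x) + k) ≡⟨ cong (_+_ (inv x)) (m+[n∸m]≡n (≰⇒> c≰)) ⟩
  inv x + c                    ∎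
  where
  k = c ∸ suc ((# up) x)

  rearrange : ∀ a b c → a + (b + c) ≡ b + (a + c)
  rearrange = solve-∀

  k≤ : k ≤ (# right) x
  -- The bound on `c` says that `c` is at most `suc ((# up) x) + (# right) x`; subtracting
  -- `suc ((# up) x)` leaves the bound on `k`.
  k≤ = subst (k ≤_) (m+n∸m≡n (suc ((# up) x)) _)
         (∸-monoˡ-≤ (suc ((# up) x)) (s≤s⁻¹ (subst (c <_) (+-comm _ 2) c<)))

-- Residue classes

-- The difference of `c` and `d` is a multiple of `m` whose absolute value is at most the larger of
-- the two, hence below `m`; so it vanishes.
residue-unique : ∀ {m a} n {c d} → c < m → d < m →
                 + (n + c) ≡ a [mod m ] → + (n + d) ≡ a [mod m ] → c ≡ d
residue-unique {m} {a} n {c} {d} c<m d<m c≡ d≡ =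
  ℤ.+-injective (i-j≡0⇒i≡j (+ c) (+ d) (trans ([+m]-[+n]≡m⊖n c d) (∣i∣≡0⇒i≡0 ∣c⊖d∣≡0)))
  where
  rearrange : ∀ n c d a → (n ℤ.+ c ℤ.- a) ℤ.- (n ℤ.+ d ℤ.- a) ≡ c ℤ.- d
  rearrange = ℤ-solve-∀

  m∣c⊖d : m ∣ ∣ c ℤ.⊖ d ∣
  m∣c⊖d = subst (λ i → m ∣ ∣ i ∣)
    (trans (rearrange (+ n) (+ c) (+ d) a) ([+m]-[+n]≡m⊖n c d))
    (Signed.∣⇒∣ᵤ (Signed.∣m∣n⇒∣m-n (Signed.∣ᵤ⇒∣ {+ m} {+ (n + c) ℤ.- a} c≡)
                                   (Signed.∣ᵤ⇒∣ {+ m} {+ (n + d) ℤ.- a} d≡)))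

  ∣c⊖d∣≡0 : ∣ c ℤ.⊖ d ∣ ≡ 0
  ∣c⊖d∣≡0 = <∧∣⇒≡0 (≤-<-trans (∣m⊝n∣≤m⊔n c d) (⊔-lub c<m d<m)) m∣c⊖d
    where
    <∧∣⇒≡0 : ∀ {k} → k < m → m ∣ k → k ≡ 0
    <∧∣⇒≡0 {zero}  _   _   = refl
    <∧∣⇒≡0 {suc k} k<m m∣k = contradiction (∣⇒≤ m∣k) (<⇒≱ k<m)

-- The witness is the remainder of `a - n` on division by `m`; the negated quotient is the cofactor
-- that proves the congruence.
residue-exists : ∀ m .{{_ : NonZero m}} a n → ∃[ c ] (c < m × + (n + c) ≡ a [mod m ])
residue-exists m a n = c , n%ℕd<d (a ℤ.- + n) m ,
  Signed.∣⇒∣ᵤ (Signed.divides {+ m} {+ (n + c) ℤ.- a} (ℤ.- q) (begin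
    + n ℤ.+ + c ℤ.- a
      ≡⟨ split (+ n) (+ c) a ⟩
    + c ℤ.- (a ℤ.- + n)
      ≡⟨ cong (ℤ._-_ (+ c)) (a≡a%ℕn+[a/ℕn]*n (a ℤ.- + n) m) ⟩
    + c ℤ.- (+ c ℤ.+ q ℤ.* + m)
      ≡⟨ cancel (+ c) q (+ m) ⟩
    ℤ.- q ℤ.* + m ∎))
  where
  c = (a ℤ.- + n) %ℕ m
  q = (a ℤ.- + n) /ℕ m

  split : ∀ n c a → n ℤ.+ c ℤ.- a ≡ c ℤ.- (a ℤ.- n)
  split = ℤ-solve-∀

  cancel : ∀ c q m → c ℤ.- (c ℤ.+ q ℤ.* m) ≡ ℤ.- q ℤ.* m
  cancel = ℤ-solve-∀

-- The blocks form a partition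

step-occurs : ∀ s {n} p → (# s) p ≡ suc n → ∃[ j ] lookup p j ≡ s
step-occurs up    (up    ∷ p) _  = zero , refl
step-occurs up    (right ∷ p) eq = Product.map suc id (step-occurs up p eq)
step-occurs right (up    ∷ p) eq = Product.map suc id (step-occurs right p eq)
step-occurs right (right ∷ p) _  = zero , refl

-- Since `y` is an extension of `x`, its step counts exceed those of `x` by one each, and the
-- successors cancel.
∈-dS⇒∈-𝕐 : ∀ {v h x} y → y ∈ 𝕐 (suc v) (suc h) → x ∈ dS-PATH y → x ∈ 𝕐 v h
∈-dS⇒∈-𝕐 {x = x} y (u , r) x∈ with ∈-dS⇒extend y x∈
... | c , _ , refl with extend-𝕐 {x = x} c (refl , refl)
... | u′ , r′ = suc-injective (trans (sym u′) u) , suc-injective (trans (sym r′) r)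

dS-nonempty : ∀ {v h} y → y ∈ 𝕐 (suc v) (suc h) → ∃[ x ] x ∈ dS-PATH y
dS-nonempty (up ∷ ys) (_ , r) with step-occurs right ys r
... | j , l = _ , j , l , refl
dS-nonempty (right ∷ ys) (u , _) with step-occurs up ys u
... | j , l = _ , j , l , refl

∈-𝕐⁺⇒inv : ∀ {v h} a y → y ∈ 𝕐⁺ v h a → + inv y ≡ a [mod v + h + 2 ]
∈-𝕐⁺⇒inv {v} {h} a y (y∈ , y≡) =
  subst (λ n → + n ≡ a [mod v + h + 2 ]) (length-upperLeftCells {p = y} y∈) y≡

inv⇒∈-𝕐⁺ : ∀ {v h} a y → y ∈ 𝕐 (suc v) (suc h) → + inv y ≡ a [mod v + h + 2 ] → y ∈ 𝕐⁺ v h a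
inv⇒∈-𝕐⁺ {v} {h} a y y∈ y≡ =
  y∈ , subst (λ n → + n ≡ a [mod v + h + 2 ]) (sym (length-upperLeftCells {p = y} y∈)) y≡

-- Both paths are extensions of `x`, and their excesses lie in the same residue class and below the
-- modulus, so they coincide.
dS-injective : ∀ {v h} a {x} y z → y ∈ 𝕐⁺ v h a → z ∈ 𝕐⁺ v h a →
               x ∈ dS-PATH y → x ∈ dS-PATH z → y ≡ z
dS-injective a {x} y z y∈ z∈ x∈y x∈z with ∈-dS⇒∈-𝕐 y (proj₁ y∈) x∈y
-- Identifying `v` and `h` with the step counts of `x` makes the modulus equal to the bound on the
-- excesses.
... | refl , refl with ∈-dS⇒extend y x∈y | ∈-dS⇒extend z x∈z
... | c , c< , refl | d , d< , refl =
  cong (extend x) (residue-unique {a = a} (inv x) c< d< (excess c< y∈) (excess d< z∈))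
  where
  m = (# up) x + (# right) x + 2

  excess : ∀ {c} → c < m → extend x c ∈ 𝕐⁺ ((# up) x) ((# right) x) a →
           + (inv x + c) ≡ a [mod m ]
  excess {c} c< y∈ = subst (λ n → + n ≡ a [mod m ]) (inv-extend x c c<)
                       (∈-𝕐⁺⇒inv a (extend x c) y∈)

-- The path is the extension of `x` whose excess is the representative of `a - inv x` below the
-- modulus.
dS-covers : ∀ {v h} a {x} → x ∈ 𝕐 v h → ∃[ y ] (y ∈ 𝕐⁺ v h a × x ∈ dS-PATH y)
dS-covers a {x} (refl , refl) with residue-exists m {{>-nonZero m>0}} a (inv x)
  where
  m = (# up) x + (# right) x + 2

  m>0 : 0 < m
  m>0 = m≤n⇒m≤o+n ((# up) x + (# right) x) z<s
... | c , c< , c≡ =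
  extend x c ,
  inv⇒∈-𝕐⁺ a (extend x c) (extend-𝕐 {x = x} c (refl , refl))
    (subst (λ n → + n ≡ a [mod (# up) x + (# right) x + 2 ]) (sym (inv-extend x c c<)) c≡) ,
  ∈-dS-extend x c

theorem8p2 : (v h : ℕ) (a : ℤ) → IsPartition (𝕐⁺ v h a) dS-PATH (𝕐 v h)
theorem8p2 v h a = record
  { nonempty = λ {y} y∈ → dS-nonempty y (proj₁ y∈)
  ; disjoint = λ {y} {z} y∈ z∈ y≢z (x∈y , x∈z) → y≢z (dS-injective a y z y∈ z∈ x∈y x∈z)
  ; union    = (λ (y , y∈ , x∈y) → ∈-dS⇒∈-𝕐 y (proj₁ y∈) x∈y) , dS-covers a
  }
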